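{- The inclusion $B_{1} \subseteq B_{3}^{m}$ holds, i.e. every graph that has an EPG representation in which each path has at most one bend also has an EPG representation in which each path is monotonic and has at most three bends.
   Context: All graphs are finite and simple. A grid consists of horizontal grid lines (rows, increasing from bottom to top) and vertical grid lines (columns, increasing from left to right). A grid point is a crossing of two grid lines. A grid edge is the part of a grid line between two consecutive grid points. A path on a grid consists of two grid points (its end points) and a number of consecutive grid edges connecting them. A bend of a path is a turn of the path at a grid point. An EPG representation of a graph $G$ assigns to each vertex $v$ of $G$ a path $P_v$ on a common grid such that two distinct vertices $v,w$ are adjacent in $G$ if and only if $P_v$ and $P_w$ share at least one grid edge. A path is monotonic if it is ascending in both columns and rows, i.e. it has the shape of a staircase going upwards from left to right. For a nonnegative integer $k$, $B_k$ is the class of all graphs that have an EPG representation in which every path has at most $k$ bends, and $B_k^m$ (the superscript $m$ is just a symbol for "monotonic") is the class of all graphs that have an EPG representation in which every path is monotonic and has at most $k$ bends. -}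

module Defs where

open import Data.Bool using (if_then_else_)
open import Data.Fin using (Fin)
open import Data.List using (List; _∷_; length)
open import Data.List.Relation.Unary.All using (All)
open import Data.List.Relation.Unary.Linked using (Linked)
open import Data.List.Relation.Unary.Unique.Propositional using (Unique)
open import Data.Nat using (ℕ; suc; _≤_; _<_; _≟_)
open import Data.Product using (Σ; ∃₂; _×_)
open import Data.Sum using (_⊎_)
open import Function using (_⇔_; flip)
open import Level using (0ℓ)
open import Relation.Binary using (Rel; Symmetric; Irreflexive; Decidable)
open import Relation.Binary.PropositionalEquality using (_≡_; _≢_)
open import Relation.Nullary using (Dec; does)
open import Relation.Nullary.Decidable using (_×-dec_; _⊎-dec_)
open import Relation.Unary using (Pred)

record Graph : Set₁ where
  field
    order  : ℕ
    _~_    : Rel (Fin order) 0ℓ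
    irrefl : Irreflexive _≡_ _~_
    sym    : Symmetric _~_
    _~?_   : Decidable _~_

  Vertex : Set
  Vertex = Fin order

record Grid : Set where
  field
    columns rows : ℕ

record Point : Set where
  constructor pt
  field
    col row : ℕ

open Point public

OnGrid : Grid → Pred Point 0ℓ
OnGrid Γ p = col p < Grid.columns Γ × row p < Grid.rows Γ

Successive : Rel ℕ 0ℓ
Successive i j = j ≡ suc i ⊎ i ≡ suc j

successive? : Decidable Successive
successive? i j = (j ≟ suc i) ⊎-dec (i ≟ suc j)

-- Horizontal p q and Vertical p q: p and q are the two ends, in either order,
-- of a grid edge on a horizontal (resp. vertical) grid line.
Horizontal Vertical GridEdge : Rel Point 0ℓ
Horizontal p q = row p ≡ row q × Successive (col p) (col q)
Vertical   p q = col p ≡ col q × Successive (row p) (row q)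
GridEdge   p q = Horizontal p q ⊎ Vertical p q

horizontal? : Decidable Horizontal
horizontal? p q = (row p ≟ row q) ×-dec successive? (col p) (col q)

vertical? : Decidable Vertical
vertical? p q = (col p ≟ col q) ×-dec successive? (row p) (row q)

-- A path is given by the grid points it visits, listed from one end point to
-- the other.  Paths are simple and have two distinct end points.
record Path (Γ : Grid) : Set where
  field
    points     : List Point
    onGrid     : All (OnGrid Γ) points
    connected  : Linked GridEdge points
    simple     : Unique points
    nontrivial : 2 ≤ length points

open Path public

data Consecutive (p q : Point) : List Point → Set where
  here  : ∀ {ps} → Consecutive p q (p ∷ q ∷ ps)
  there : ∀ {r ps} → Consecutive p q ps → Consecutive p q (r ∷ ps)

module _ {Γ : Grid} where

  -- Grid edges are undirected, so the direction of traversal is irrelevant.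
  Uses : Path Γ → Rel Point 0ℓ
  Uses P p q = Consecutive p q (points P) ⊎ Consecutive q p (points P)

  ShareEdge : Rel (Path Γ) 0ℓ
  ShareEdge P Q = ∃₂ λ p q → Uses P p q × Uses Q p q

Bend : Point → Point → Point → Set
Bend p q r = (Horizontal p q × Vertical q r) ⊎ (Vertical p q × Horizontal q r)

bend? : ∀ p q r → Dec (Bend p q r)
bend? p q r = (horizontal? p q ×-dec vertical? q r)
        ⊎-dec (vertical? p q ×-dec horizontal? q r)

countBends : List Point → ℕ
countBends (p ∷ q ∷ r ∷ ps) =
  if does (bend? p q r) then suc (countBends (q ∷ r ∷ ps))
                        else countBends (q ∷ r ∷ ps)
countBends _ = 0

bends : ∀ {Γ} → Path Γ → ℕ
bends P = countBends (points P)

_≤ᵖ_ : Rel Point 0ℓ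
p ≤ᵖ q = col p ≤ col q × row p ≤ row q

-- Paths have no orientation: the points of an ascending path may be listed
-- from its lower left end or from its upper right end.
Monotonic : ∀ {Γ} → Pred (Path Γ) 0ℓ
Monotonic P = Linked _≤ᵖ_ (points P) ⊎ Linked (flip _≤ᵖ_) (points P)

record EPG (G : Graph) : Set where
  open Graph G
  field
    grid     : Grid
    path     : Vertex → Path grid
    adjacent : ∀ v w → v ≢ w → (v ~ w) ⇔ ShareEdge (path v) (path w)

open EPG public using (path)

B : ℕ → Pred Graph 0ℓ
B k G = Σ (EPG G) λ R → ∀ v → bends (path R v) ≤ k

Bᵐ : ℕ → Pred Graph 0ℓ
Bᵐ k G = Σ (EPG G) λ R → ∀ v → Monotonic (path R v) × bends (path R v) ≤ k

{-# OPTIONS --safe #-}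

-- Edge sharing only depends on the horizontal and the vertical segment of each
-- path; where these two segments lie relative to each other is irrelevant.  So
-- all horizontal segments are kept in a lower left block of a new grid, all
-- vertical segments are moved to an upper right block, and the right end of the
-- horizontal segment is joined to the lower end of the vertical one by an
-- upward and then a rightward connection.  If the coordinates of these ends are
-- pairwise distinct, every connection runs on grid lines of its own and
-- creates no new shared edge.
module Submission where

open import Defs
open import Data.Bool using (true; false)
open import Data.Empty using (⊥-elim)
open import Data.Fin using (Fin; zero; suc; toℕ)
open import Data.Fin.Properties using (toℕ<n; toℕ-injective)
open import Data.List using (List; []; _∷_; _++_; replicate; length)
open import Data.List.Relation.Unary.All as All using (All; []; _∷_)
open import Data.List.Relation.Unary.AllPairs using ([]; _∷_)
open import Data.List.Relation.Unary.Linked using (Linked; []; [-]; _∷_)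
open import Data.List.Relation.Unary.Unique.Propositional using (Unique)
open import Data.Nat using (ℕ; zero; suc; _+_; _*_; _∸_; _⊔_; _⊓_; _≤_; _<_; _<?_; _≤?_; z≤n; s≤s)
open import Data.Nat.Properties
open import Data.Product using (∃; ∃₂; _×_; _,_; proj₁; proj₂)
open import Data.Sum using (_⊎_; inj₁; inj₂; swap)
open import Function using (_⇔_; mk⇔; Equivalence; _∘_)
open import Relation.Binary using (Rel; tri<; tri≈; tri>)
open import Relation.Binary.PropositionalEquality
open import Relation.Nullary using (¬_; does; yes; no; contradiction)
open import Relation.Nullary.Decidable using (dec-true; dec-false)
open import Relation.Unary using (_⊆_; Pred)
open import Level using (0ℓ)

open Equivalence using (to; from)

-- Axes, unit edges and segments

data Axis : Set where
  hor ver : Axis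

opposite : Axis → Axis
opposite hor = ver
opposite ver = hor

along across : Axis → Point → ℕ
along hor = col
along ver = row
across A = along (opposite A)

point : Axis → (x y : ℕ) → Point
point hor x y = pt x y
point ver x y = pt y x

step : Axis → Point → Point
step A p = point A (suc (along A p)) (across A p)

along-point : ∀ A {x y} → along A (point A x y) ≡ x
along-point hor = refl
along-point ver = refl

across-point : ∀ A {x y} → across A (point A x y) ≡ y
across-point hor = refl
across-point ver = refl

along-step : ∀ A {p} → along A (step A p) ≡ suc (along A p)
along-step A = along-point A

across-step : ∀ A {p} → across A (step A p) ≡ across A p
across-step A = across-point A

point-ext : ∀ A {p q} → across A p ≡ across A q → along A p ≡ along A q → p ≡ q
point-ext hor refl refl = refl
point-ext ver refl refl = refl

Edge : Axis → Rel Point 0ℓ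
Edge A p q = across A p ≡ across A q × Successive (along A p) (along A q)

gridEdge⇒edge : ∀ {p q} → GridEdge p q → ∃ λ A → Edge A p q
gridEdge⇒edge (inj₁ e) = hor , e
gridEdge⇒edge (inj₂ e) = ver , e

edge⇒gridEdge : ∀ A {p q} → Edge A p q → GridEdge p q
edge⇒gridEdge hor = inj₁
edge⇒gridEdge ver = inj₂

edge⇒step : ∀ A {p q} → Edge A p q → q ≡ step A p ⊎ p ≡ step A q
edge⇒step A (eq , inj₁ s) = inj₁ (point-ext A (trans (sym eq) (sym (across-step A))) (trans s (sym (along-step A))))
edge⇒step A (eq , inj₂ s) = inj₂ (point-ext A (trans eq (sym (across-step A))) (trans s (sym (along-step A))))

step-edge : ∀ A {p} → Edge A p (step A p)
step-edge A = sym (across-step A) , inj₁ (along-step A)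

not-successive : ∀ {m} → ¬ Successive m m
not-successive (inj₁ ())
not-successive (inj₂ ())

edge-axis-unique : ∀ A B {p q} → Edge A p q → Edge B p q → A ≡ B
edge-axis-unique hor hor _ _ = refl
edge-axis-unique ver ver _ _ = refl
edge-axis-unique hor ver (refl , _) (_ , s) = ⊥-elim (not-successive s)
edge-axis-unique ver hor (refl , _) (_ , s) = ⊥-elim (not-successive s)

edge-sym : ∀ A {p q} → Edge A p q → Edge A q p
edge-sym A (eq , inj₁ s) = sym eq , inj₂ s
edge-sym A (eq , inj₂ s) = sym eq , inj₁ s

opposite≢ : ∀ A → A ≢ opposite A
opposite≢ hor ()
opposite≢ ver ()

axes : ∀ A B → B ≡ A ⊎ B ≡ opposite A
axes hor hor = inj₁ refl
axes hor ver = inj₂ refl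
axes ver hor = inj₂ refl
axes ver ver = inj₁ refl

record Segment : Set where
  constructor seg
  field
    line lo hi : ℕ

open Segment

-- The unit edge from x to step A x lies on the segment.
On : Axis → Segment → Pred Point 0ℓ
On A S x = across A x ≡ line S × lo S ≤ along A x × along A x < hi S

Nonempty : Pred Segment 0ℓ
Nonempty S = lo S < hi S

-- Covering segments may be empty, and the two cross inequalities alone would accept an empty
-- segment strictly inside another one; hence the two nonemptiness conditions.
Overlap : Rel Segment 0ℓ
Overlap S T = line S ≡ line T × (lo S < hi T × lo T < hi S) × Nonempty S × Nonempty T

overlap⇔common : ∀ A {S T} → Overlap S T ⇔ ∃ λ x → On A S x × On A T x
overlap⇔common A {S} {T} = mk⇔ common overlaps
  where
  common : Overlap S T → ∃ λ x → On A S x × On A T x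
  -- The first common unit edge starts at the larger of the two lower ends; the four strict
  -- inequalities of `Overlap` keep it below both upper ends.
  common (l , (st , ts) , s , t) = point A (lo S ⊔ lo T) (line S)
    , (across-point A , subst (λ m → lo S ≤ m × m < hi S) (sym (along-point A)) (m≤m⊔n _ _ , ⊔-lub s ts))
    , (trans (across-point A) l , subst (λ m → lo T ≤ m × m < hi T) (sym (along-point A)) (m≤n⊔m _ _ , ⊔-lub st t))

  overlaps : (∃ λ x → On A S x × On A T x) → Overlap S T
  overlaps (x , (l , a , b) , (m , c , d)) =
    trans (sym l) m , (≤-<-trans a d , ≤-<-trans c b) , ≤-<-trans a b , ≤-<-trans c d

-- Edges used by a list of points

UsesEdge : Axis → Point → List Point → Set
UsesEdge A x ps = Consecutive x (step A x) ps ⊎ Consecutive (step A x) x ps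

usesEdge-there : ∀ {A x p ps} → UsesEdge A x ps → UsesEdge A x (p ∷ ps)
usesEdge-there (inj₁ c) = inj₁ (there c)
usesEdge-there (inj₂ c) = inj₂ (there c)

usesEdge-∷ : ∀ {A x p q ps} → UsesEdge A x (p ∷ q ∷ ps) →
             (x ≡ p × q ≡ step A x) ⊎ (x ≡ q × p ≡ step A x) ⊎ UsesEdge A x (q ∷ ps)
usesEdge-∷ (inj₁ here)      = inj₁ (refl , refl)
usesEdge-∷ (inj₂ here)      = inj₂ (inj₁ (refl , refl))
usesEdge-∷ (inj₁ (there c)) = inj₂ (inj₂ (inj₁ c))
usesEdge-∷ (inj₂ (there c)) = inj₂ (inj₂ (inj₂ c))

usesEdge-[-] : ∀ {A x p} → ¬ UsesEdge A x (p ∷ [])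
usesEdge-[-] (inj₁ (there ()))
usesEdge-[-] (inj₂ (there ()))

consecutive⇒related : ∀ {R : Rel Point 0ℓ} {p q ps} → Linked R ps → Consecutive p q ps → R p q
consecutive⇒related (r ∷ _)  here      = r
consecutive⇒related (_ ∷ rs) (there c) = consecutive⇒related rs c
consecutive⇒related [-] (there ())

-- An undirected edge is determined by its axis and its end with the smaller coordinate. In this
-- normal form only the point `x` has to be compared with segments.
shareEdge⇔ : ∀ {Γ} {P Q : Path Γ} →
             ShareEdge P Q ⇔ ∃₂ λ A x → UsesEdge A x (points P) × UsesEdge A x (points Q)
shareEdge⇔ {P = P} {Q} = mk⇔ normalise (λ (A , x , u , v) → x , step A x , u , v)
  where
  related : ∀ {p q} → Uses P p q → ∃ λ A → Edge A p q
  related (inj₁ c) = gridEdge⇒edge (consecutive⇒related (connected P) c)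
  related (inj₂ c) with A , e ← gridEdge⇒edge (consecutive⇒related (connected P) c) = A , edge-sym A e

  normalise : ShareEdge P Q → ∃₂ λ A x → UsesEdge A x (points P) × UsesEdge A x (points Q)
  normalise (p , q , u , v) with related u
  ... | A , e with edge⇒step A e
  ...   | inj₁ refl = A , p , u , v
  ...   | inj₂ refl = A , q , swap u , swap v

-- Paths with at most one bend

-- This is what the bound of one bend provides on each axis; a second bend could put two separate
-- segments on the same axis.
Covered : Axis → List Point → Set
Covered A ps = ∃ λ S → ∀ x → UsesEdge A x ps ⇔ On A S x

-- The covering segment must contain the first point p for the induction.
CoveredThrough : Axis → Point → List Point → Set
CoveredThrough A p ps = ∃₂ λ a b → a ≤ along A p × along A p ≤ b ×
  (∀ x → UsesEdge A x (p ∷ ps) ⇔ On A (seg (across A p) a b) x)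

forget : ∀ {A p ps} → CoveredThrough A p ps → Covered A (p ∷ ps)
forget (a , b , _ , _ , e) = seg _ a b , e

unused⇒coveredThrough : ∀ {A p ps} → (∀ {x} → ¬ UsesEdge A x (p ∷ ps)) → CoveredThrough A p ps
-- The empty segment is placed at `p`, ready to be extended by an edge ending in `p`.
unused⇒coveredThrough {A} {p} ¬u = along A p , along A p , ≤-refl , ≤-refl ,
  λ x → mk⇔ (λ u → contradiction u ¬u) (λ (_ , l , r) → contradiction r (≤⇒≯ l))

-- Since `q` lies between `a` and `b`, the new unit edge is already covered or prolongs the segment
-- at one end. The minimum or maximum describes the union in both cases.
coveredThrough-∷ : ∀ {A p q ps} → Edge A p q → CoveredThrough A q ps → CoveredThrough A p (q ∷ ps)
coveredThrough-∷ {A} {p} {q} {ps} e (a , b , a≤q , q≤b , eqv) with edge⇒step A e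
... | inj₁ refl = a ⊓ along A p , b , m⊓n≤n _ _ , p≤b , λ x → mk⇔ (fwd x) (bwd x)
  where
  p<b : along A p < b
  p<b = subst (_≤ b) (along-step A) q≤b

  p≤b : along A p ≤ b
  p≤b = <⇒≤ p<b

  fwd : ∀ x → UsesEdge A x (p ∷ step A p ∷ ps) → On A (seg (across A p) (a ⊓ along A p) b) x
  fwd x u with usesEdge-∷ u
  ... | inj₁ (refl , _)        = refl , m⊓n≤n _ _ , p<b
  -- Here `p` would lie two steps beyond itself.
  ... | inj₂ (inj₁ (refl , eq)) =
    contradiction (trans (cong (along A) eq) (trans (along-step A) (cong suc (along-step A)))) (m≢1+n+m _ {1})
  ... | inj₂ (inj₂ u′) with l , m , n ← to (eqv x) u′ =
    trans l (across-step A) , ≤-trans (m⊓n≤m _ _) m , n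

  bwd : ∀ x → On A (seg (across A p) (a ⊓ along A p) b) x → UsesEdge A x (p ∷ step A p ∷ ps)
  bwd x (l , m , n) with a ≤? along A x
  ... | yes a≤x = usesEdge-there (from (eqv x) (trans l (sym (across-step A)) , a≤x , n))
  -- Left of `a` only the new edge remains: `a` is at most one step beyond `p`, so `x` is squeezed
  -- onto `p`.
  ... | no a≰x = subst (λ y → UsesEdge A y _) (point-ext A (sym l) (≤-antisym p≤x x≤p)) (inj₁ here)
    where
    x≤p : along A x ≤ along A p
    x≤p = ≤-pred (≤-trans (≰⇒> a≰x) (subst (a ≤_) (along-step A) a≤q))

    p≤x : along A p ≤ along A x
    p≤x with ⊓-sel a (along A p)
    ... | inj₁ eq = contradiction (subst (_≤ _) eq m) a≰x
    ... | inj₂ eq = subst (_≤ _) eq m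
... | inj₂ refl = a , b ⊔ along A p , a≤p , m≤n⊔m _ _ , λ x → mk⇔ (fwd x) (bwd x)
  where
  q<p : along A q < along A p
  q<p = ≤-reflexive (sym (along-step A))

  a≤p : a ≤ along A p
  a≤p = ≤-trans a≤q (<⇒≤ q<p)

  fwd : ∀ x → UsesEdge A x (step A q ∷ q ∷ ps) → On A (seg (across A p) a (b ⊔ along A p)) x
  fwd x u with usesEdge-∷ u
  ... | inj₁ (refl , eq) =
    contradiction (trans (cong (along A) eq) (trans (along-step A) (cong suc (along-step A)))) (m≢1+n+m _ {1})
  ... | inj₂ (inj₁ (refl , _)) = sym (across-step A) , a≤q , m≤n⇒m≤o⊔n b q<p
  ... | inj₂ (inj₂ u′) with l , m , n ← to (eqv x) u′ =
    trans l (sym (across-step A)) , m , m≤n⇒m≤n⊔o _ n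

  bwd : ∀ x → On A (seg (across A p) a (b ⊔ along A p)) x → UsesEdge A x (step A q ∷ q ∷ ps)
  bwd x (l , m , n) with along A x <? b
  ... | yes x<b = usesEdge-there (from (eqv x) (trans l (across-step A) , m , x<b))
  ... | no x≮b = subst (λ y → UsesEdge A y _)
      (point-ext A (sym (trans l (across-step A))) (≤-antisym q≤x x≤q)) (inj₂ here)
    where
    q≤x : along A q ≤ along A x
    q≤x = ≤-trans q≤b (≮⇒≥ x≮b)

    x≤q : along A x ≤ along A q
    x≤q with ⊔-sel b (along A p)
    ... | inj₁ eq = contradiction (subst (_ <_) eq n) x≮b
    ... | inj₂ eq = ≤-pred (subst (_ <_) (trans eq (along-step A)) n)

linked⇒coveredThrough : ∀ {A p ps} → Linked (Edge A) (p ∷ ps) → CoveredThrough A p ps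
linked⇒coveredThrough [-]      = unused⇒coveredThrough usesEdge-[-]
linked⇒coveredThrough (e ∷ es) = coveredThrough-∷ e (linked⇒coveredThrough es)

-- The shape of a path with at most one bend. The corner is the first point of the list under
-- `turn`, and that list may have no edge, so straight paths are included.
data Elbow (A : Axis) : List Point → Set where
  turn : ∀ {ps} → Linked (Edge (opposite A)) ps → Elbow A ps
  _∷_  : ∀ {p q ps} → Edge A p q → Elbow A (q ∷ ps) → Elbow A (p ∷ q ∷ ps)

usesEdge⇒edge : ∀ {A B x ps} → Linked (Edge B) ps → UsesEdge A x ps → Edge B x (step A x)
usesEdge⇒edge     es (inj₁ c) = consecutive⇒related es c
usesEdge⇒edge {B = B} es (inj₂ c) = edge-sym B (consecutive⇒related es c)

-- Beyond the corner no edge has axis `A`, so the induction starts there with an empty segment.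
elbow⇒coveredThrough : ∀ {A p ps} → Elbow A (p ∷ ps) → CoveredThrough A p ps
elbow⇒coveredThrough {A} (turn es) = unused⇒coveredThrough λ u →
  opposite≢ A (edge-axis-unique A (opposite A) (step-edge A) (usesEdge⇒edge {A} {opposite A} es u))
elbow⇒coveredThrough (e ∷ es) = coveredThrough-∷ e (elbow⇒coveredThrough es)

-- The edges before the corner contribute nothing on the opposite axis, so the segment found after
-- the turn is kept unchanged.
elbow⇒covered-opposite : ∀ {A p ps} → Elbow A (p ∷ ps) → Covered (opposite A) (p ∷ ps)
elbow⇒covered-opposite (turn es) = forget (linked⇒coveredThrough es)
elbow⇒covered-opposite {A} {p} (_∷_ {q = q} {ps} e es) with elbow⇒covered-opposite es
... | S , eqv = S , λ x → mk⇔ (to (eqv x) ∘ drop) (usesEdge-there ∘ from (eqv x))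
  where
  drop : ∀ {x} → UsesEdge (opposite A) x (p ∷ q ∷ ps) → UsesEdge (opposite A) x (q ∷ ps)
  drop u with usesEdge-∷ u
  ... | inj₁ (refl , refl) =
    contradiction (edge-axis-unique A (opposite A) e (step-edge (opposite A))) (opposite≢ A)
  ... | inj₂ (inj₁ (refl , refl)) =
    contradiction (edge-axis-unique A (opposite A) (edge-sym A e) (step-edge (opposite A))) (opposite≢ A)
  ... | inj₂ (inj₂ u′) = u′

elbow⇒covered : ∀ {A p ps} → Elbow A (p ∷ ps) → ∀ B → Covered B (p ∷ ps)
elbow⇒covered {A} el B with axes A B
... | inj₁ refl = forget (elbow⇒coveredThrough el)
... | inj₂ refl = elbow⇒covered-opposite el

bend : ∀ A {p q r} → Edge A p q → Edge (opposite A) q r → Bend p q r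
bend hor e f = inj₁ (e , f)
bend ver e f = inj₂ (e , f)

countBends-tail : ∀ p q r ps → countBends (q ∷ r ∷ ps) ≤ countBends (p ∷ q ∷ r ∷ ps)
countBends-tail p q r ps with does (bend? p q r)
... | true  = n≤1+n _
... | false = ≤-refl

countBends-bend : ∀ {p q r} ps → Bend p q r → countBends (p ∷ q ∷ r ∷ ps) ≡ suc (countBends (q ∷ r ∷ ps))
countBends-bend {p} {q} {r} ps b rewrite dec-true (bend? p q r) b = refl

countBends-straight : ∀ {p q r} ps → ¬ Bend p q r → countBends (p ∷ q ∷ r ∷ ps) ≡ countBends (q ∷ r ∷ ps)
countBends-straight {p} {q} {r} ps ¬b rewrite dec-false (bend? p q r) ¬b = refl

countBends-∷ : ∀ p ps → countBends (p ∷ ps) ≤ suc (countBends ps)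
countBends-∷ p []           = z≤n
countBends-∷ p (q ∷ [])     = z≤n
countBends-∷ p (q ∷ r ∷ ps) with does (bend? p q r)
... | true  = ≤-refl
... | false = n≤1+n _

bendless⇒linked : ∀ {A p q ps} → Linked GridEdge (q ∷ ps) → Edge A p q →
                  countBends (p ∷ q ∷ ps) ≤ 0 → Linked (Edge A) (p ∷ q ∷ ps)
bendless⇒linked [-] e _ = e ∷ [-]
bendless⇒linked {A} {p} {q} {r ∷ ps} (g ∷ gs) e b with gridEdge⇒edge g
... | B , f with axes A B
...   | inj₁ refl = e ∷ bendless⇒linked {A} gs f (≤-trans (countBends-tail p q r ps) b)
...   | inj₂ refl = contradiction (subst (_≤ 0) (countBends-bend ps (bend A e f)) b) λ ()

-- The first change of axis uses up the single bend, so everything after it is straight.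
oneBend⇒elbow : ∀ {A p q ps} → Linked GridEdge (q ∷ ps) → Edge A p q →
                countBends (p ∷ q ∷ ps) ≤ 1 → Elbow A (p ∷ q ∷ ps)
oneBend⇒elbow [-] e _ = e ∷ turn [-]
oneBend⇒elbow {A} {p} {q} {r ∷ ps} (g ∷ gs) e b with gridEdge⇒edge g
... | B , f with axes A B
...   | inj₁ refl = e ∷ oneBend⇒elbow gs f (≤-trans (countBends-tail p q r ps) b)
...   | inj₂ refl = e ∷ turn (bendless⇒linked {opposite A} gs f (≤-pred (subst (_≤ 1) (countBends-bend ps (bend A e f)) b)))

oneBend⇒covered : ∀ {ps} → Linked GridEdge ps → 2 ≤ length ps → countBends ps ≤ 1 → ∀ A → Covered A ps
oneBend⇒covered [-] (s≤s ())
oneBend⇒covered (g ∷ gs) _ b = let A , e = gridEdge⇒edge g in elbow⇒covered (oneBend⇒elbow {A} gs e b)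

-- Ascending walks

-- The split into `walk` and `trail` lets every walk compute to its first point followed by a rest,
-- whatever the list of axes is.
walk trail : Point → List Axis → List Point
walk p As = p ∷ trail p As
trail p []       = []
trail p (A ∷ As) = walk (step A p) As

step-≤ᵖ : ∀ A {p} → p ≤ᵖ step A p
step-≤ᵖ hor = n≤1+n _ , ≤-refl
step-≤ᵖ ver = ≤-refl , n≤1+n _

walk-connected : ∀ p As → Linked GridEdge (walk p As)
walk-connected p []       = [-]
walk-connected p (A ∷ As) = edge⇒gridEdge A (step-edge A) ∷ walk-connected (step A p) As

walk-ascending : ∀ p As → Linked _≤ᵖ_ (walk p As)
walk-ascending p []       = [-]
walk-ascending p (A ∷ As) = step-≤ᵖ A ∷ walk-ascending (step A p) As

-- Every step of either axis raises this antidiagonal index. Hence walks are simple and never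
-- traverse an edge downwards.
height : Point → ℕ
height p = col p + row p

height-step : ∀ A {p} → height p < height (step A p)
height-step hor = ≤-refl
height-step ver {p} = ≤-reflexive (sym (+-suc (col p) (row p)))

trail-higher : ∀ p As → All (λ q → height p < height q) (trail p As)
trail-higher p []       = []
trail-higher p (A ∷ As) =
  height-step A ∷ All.map (<-trans (height-step A)) (trail-higher (step A p) As)

walk-unique : ∀ p As → Unique (walk p As)
walk-unique p As = All.map (λ p<q p≡q → <⇒≢ p<q (cong height p≡q)) (trail-higher p As) ∷ rest As
  where
  rest : ∀ As → Unique (trail p As)
  rest []       = []
  rest (A ∷ As) = walk-unique (step A p) As

step-injective : ∀ A B {p} → step A p ≡ step B p → A ≡ B
step-injective A B {p} eq = edge-axis-unique A B (step-edge A) (subst (Edge B p) (sym eq) (step-edge B))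

usesEdge-walk : ∀ {A B x p} As → UsesEdge B x (walk p (A ∷ As)) →
                (B ≡ A × x ≡ p) ⊎ UsesEdge B x (walk (step A p) As)
usesEdge-walk {A} {B} {x} As u with usesEdge-∷ u
... | inj₁ (refl , eq) = inj₁ (step-injective B A (sym eq) , refl)
... | inj₂ (inj₁ (refl , eq)) =
  contradiction (cong height eq) (<⇒≢ (<-trans (height-step A) (height-step B)))
... | inj₂ (inj₂ u′) = inj₂ u′

run : Axis → ℕ → List Axis → List Axis
run A k As = replicate k A ++ As

advance : Axis → ℕ → Point → Point
advance A k p = point A (k + along A p) (across A p)

advance-step : ∀ A k {p} → advance A k (step A p) ≡ advance A (suc k) p
advance-step hor k {p} = cong (λ m → pt m (row p)) (+-suc k (col p))
advance-step ver k {p} = cong (pt (col p)) (+-suc k (row p))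

advance-zero : ∀ A {p} → advance A 0 p ≡ p
advance-zero hor = refl
advance-zero ver = refl

usesEdge-run : ∀ {A B x p} k As → UsesEdge B x (walk p (run A k As)) →
  (B ≡ A × On A (seg (across A p) (along A p) (k + along A p)) x) ⊎ UsesEdge B x (walk (advance A k p) As)
usesEdge-run {A} {B} {x} {p} zero As u =
  inj₂ (subst (λ q → UsesEdge B x (walk q As)) (sym (advance-zero A)) u)
usesEdge-run {A} {B} {x} {p} (suc k) As u with usesEdge-walk (run A k As) u
... | inj₁ (refl , refl) = inj₁ (refl , refl , ≤-refl , s≤s (m≤n+m _ k))
... | inj₂ u′ with usesEdge-run k As u′
...   | inj₁ (refl , l , m , n) = inj₁ (refl , trans l (across-step A)
        , <⇒≤ (subst (_≤ _) (along-step A) m)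
        , subst (along A x <_) (trans (cong (k +_) (along-step A)) (+-suc k _)) n)
...   | inj₂ v = inj₂ (subst (λ q → UsesEdge B x (walk q As)) (advance-step A k) v)

run-usesEdge : ∀ {A x p} k As → On A (seg (across A p) (along A p) (k + along A p)) x →
               UsesEdge A x (walk p (run A k As))
run-usesEdge zero As (_ , m , n) = contradiction n (≤⇒≯ m)
run-usesEdge {A} {x} {p} (suc k) As (l , m , n) with m≤n⇒m<n∨m≡n m
... | inj₂ eq with refl ← point-ext A {x} {p} l (sym eq) = inj₁ here
... | inj₁ p<x = usesEdge-there (run-usesEdge k As
      ( trans l (sym (across-step A))
      , subst (_≤ _) (sym (along-step A)) p<x
      , subst (along A x <_) (sym (trans (cong (k +_) (along-step A)) (+-suc k _))) n))

skip-run : ∀ {A B x p} k As → UsesEdge B x (walk (advance A k p) As) → UsesEdge B x (walk p (run A k As))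
skip-run {A} {B} {x} zero As u = subst (λ q → UsesEdge B x (walk q As)) (advance-zero A) u
skip-run {A} {B} {x} (suc k) As u =
  usesEdge-there (skip-run k As (subst (λ q → UsesEdge B x (walk q As)) (sym (advance-step A k)) u))

bendless-steps : ∀ A {p} → ¬ Bend p (step A p) (step A (step A p))
bendless-steps hor (inj₁ (_ , _ , s)) = not-successive s
bendless-steps hor (inj₂ ((_ , s) , _)) = not-successive s
bendless-steps ver (inj₁ ((_ , s) , _)) = not-successive s
bendless-steps ver (inj₂ (_ , _ , s)) = not-successive s

-- Inside a run there is no bend, so only its end can add one. The bound need not be attained: the
-- run may be empty or continue straight on.
countBends-run : ∀ {A p} k As → countBends (walk p (run A k As)) ≤ suc (countBends (walk (advance A k p) As))
countBends-run {A} {p} zero As rewrite advance-zero A {p} = n≤1+n _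
countBends-run {A} {p} (suc zero) As
  rewrite sym (trans (sym (advance-zero A)) (advance-step A 0 {p})) = countBends-∷ p (walk (step A p) As)
countBends-run {A} {p} (suc (suc k)) As = ≤-trans
  (≤-reflexive (countBends-straight (trail (step A (step A p)) (run A k As)) (bendless-steps A)))
  (subst (λ q → countBends (walk (step A p) (run A (suc k) As)) ≤ suc (countBends (walk q As)))
    (advance-step A (suc k)) (countBends-run (suc k) As))

countBends-run-[] : ∀ {A p} k → countBends (walk p (run A k [])) ≡ 0
countBends-run-[] zero       = refl
countBends-run-[] (suc zero) = refl
countBends-run-[] {A} {p} (suc (suc k)) =
  trans (countBends-straight (trail (step A (step A p)) (run A k [])) (bendless-steps A)) (countBends-run-[] (suc k))

-- A single four-run staircase

module Staircase {x₀ x₁ x₂ y₀ y₁ y₂}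
  (x₀<x₁ : x₀ < x₁) (x₁≤x₂ : x₁ ≤ x₂) (y₀≤y₁ : y₀ ≤ y₁) (y₁≤y₂ : y₁ ≤ y₂) where

  rest₁ rest₂ rest₃ steps : List Axis
  rest₃ = run ver (y₂ ∸ y₁) []
  rest₂ = run hor (x₂ ∸ x₁) rest₃
  rest₁ = run ver (y₁ ∸ y₀) rest₂
  steps = run hor (x₁ ∸ x₀) rest₁

  staircase : List Point
  staircase = walk (pt x₀ y₀) steps

  -- The first and last runs are the main segments, which carry the adjacencies; the two middle runs
  -- form the connection between them.
  main link : Axis → Segment
  main hor = seg y₀ x₀ x₁
  main ver = seg x₂ y₁ y₂
  link hor = seg y₁ x₁ x₂
  link ver = seg x₁ y₀ y₁

  private
    x₁≡ : x₁ ∸ x₀ + x₀ ≡ x₁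
    x₁≡ = m∸n+n≡m (<⇒≤ x₀<x₁)
    x₂≡ : x₂ ∸ x₁ + x₁ ≡ x₂
    x₂≡ = m∸n+n≡m x₁≤x₂
    y₁≡ : y₁ ∸ y₀ + y₀ ≡ y₁
    y₁≡ = m∸n+n≡m y₀≤y₁
    y₂≡ : y₂ ∸ y₁ + y₁ ≡ y₂
    y₂≡ = m∸n+n≡m y₁≤y₂

    -- Matching on the end point rather than on the length keeps the corner
    -- points in the form pt xᵢ yⱼ.
    split : ∀ {A B x p t} k As → k + along A p ≡ t → UsesEdge B x (walk p (run A k As)) →
      (B ≡ A × On A (seg (across A p) (along A p) t) x) ⊎ UsesEdge B x (walk (point A t (across A p)) As)
    split k As refl = usesEdge-run k As

    skip : ∀ {A B x p t} k As → k + along A p ≡ t → UsesEdge B x (walk (point A t (across A p)) As) →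
      UsesEdge B x (walk p (run A k As))
    skip k As refl = skip-run k As

    bendsOf : ∀ {A p t m} k As → k + along A p ≡ t → countBends (walk (point A t (across A p)) As) ≤ m →
      countBends (walk p (run A k As)) ≤ suc m
    bendsOf k As refl le = ≤-trans (countBends-run k As) (s≤s le)

  usesEdge⇒on : ∀ A {x} → UsesEdge A x staircase → On A (main A) x ⊎ On A (link A) x
  usesEdge⇒on A u with split {hor} (x₁ ∸ x₀) rest₁ x₁≡ u
  ... | inj₁ (refl , o) = inj₁ o
  ... | inj₂ u₁ with split {ver} (y₁ ∸ y₀) rest₂ y₁≡ u₁
  ...   | inj₁ (refl , o) = inj₂ o
  ...   | inj₂ u₂ with split {hor} (x₂ ∸ x₁) rest₃ x₂≡ u₂
  ...     | inj₁ (refl , o) = inj₂ o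
  ...     | inj₂ u₃ with split {ver} (y₂ ∸ y₁) [] y₂≡ u₃
  ...       | inj₁ (refl , o) = inj₁ o
  ...       | inj₂ u₄ = contradiction u₄ usesEdge-[-]

  main⇒usesEdge : ∀ A {x} → On A (main A) x → UsesEdge A x staircase
  main⇒usesEdge hor (l , m , n) = run-usesEdge (x₁ ∸ x₀) rest₁ (l , m , subst (_ <_) (sym x₁≡) n)
  main⇒usesEdge ver (l , m , n) =
    skip {hor} {ver} (x₁ ∸ x₀) rest₁ x₁≡ (skip {ver} {ver} (y₁ ∸ y₀) rest₂ y₁≡ (skip {hor} {ver} (x₂ ∸ x₁) rest₃ x₂≡
      (run-usesEdge (y₂ ∸ y₁) [] (l , m , subst (_ <_) (sym y₂≡) n))))

  -- Four runs meet at three corners, and the last run is straight.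
  staircase-bends : countBends staircase ≤ 3
  staircase-bends =
    bendsOf {hor} (x₁ ∸ x₀) rest₁ x₁≡ (bendsOf {ver} (y₁ ∸ y₀) rest₂ y₁≡ (bendsOf {hor} (x₂ ∸ x₁) rest₃ x₂≡
      (≤-reflexive (countBends-run-[] {ver} (y₂ ∸ y₁)))))

  staircase-nontrivial : 2 ≤ length staircase
  staircase-nontrivial with x₁ ∸ x₀ | m<n⇒0<n∸m x₀<x₁
  ... | suc _ | _ = s≤s (s≤s z≤n)

-- Finite families

bounded : ∀ {n} (f : Fin n → ℕ) → ∃ λ b → ∀ v → f v < b
bounded {zero}  f = 0 , λ ()
bounded {suc n} f with bounded (f ∘ suc)
... | b , f<b = suc (f zero) ⊔ b , λ where
  zero    → m≤m⊔n _ b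
  (suc v) → m≤n⇒m≤o⊔n (suc (f zero)) (f<b v)

square : ℕ → Grid
square b = record { columns = b ; rows = b }

square-mono : ∀ {b c} → b ≤ c → OnGrid (square b) ⊆ OnGrid (square c)
square-mono b≤c (x , y) = ≤-trans x b≤c , ≤-trans y b≤c

fits : ∀ ps → ∃ λ b → All (OnGrid (square b)) ps
fits [] = 0 , []
fits (p ∷ ps) with fits ps
... | b , on = suc (col p ⊔ row p) ⊔ b
  , (m≤n⇒m≤n⊔o b (s≤s (m≤m⊔n _ _)) , m≤n⇒m≤n⊔o b (s≤s (m≤n⊔m _ _)))
  ∷ All.map (square-mono (m≤n⊔m _ b)) on

fitAll : ∀ {n} (f : Fin n → List Point) → ∃ λ b → ∀ v → All (OnGrid (square b)) (f v)
fitAll f with bounded (proj₁ ∘ fits ∘ f)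
... | b , lt = b , λ v → All.map (square-mono (<⇒≤ (lt v))) (proj₂ (fits (f v)))

-- Segments in general position

-- With blocks of length `K`, moving to a later block gains at least `K`, which outweighs any loss
-- of offset below `K`.
scale-< : ∀ K {a b x y} → a < b → x < K + y → a * K + x < b * K + y
scale-< K {a} {b} {x} {y} a<b x<K+y = begin-strict
  a * K + x       <⟨ +-monoʳ-< (a * K) x<K+y ⟩
  a * K + (K + y) ≡⟨ +-assoc (a * K) K y ⟨
  a * K + K + y   ≡⟨ cong (_+ y) (+-comm (a * K) K) ⟩
  suc a * K + y   ≤⟨ +-monoˡ-≤ y (*-monoˡ-≤ K a<b) ⟩
  b * K + y       ∎
  where open ≤-Reasoning

scale-<⁻¹ : ∀ K {a b x y} → y ≤ x → a * K + x < b * K + y → a < b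
scale-<⁻¹ K y≤x lt = ≰⇒> λ b≤a → <⇒≱ lt (+-mono-≤ (*-monoˡ-≤ K b≤a) y≤x)

-- An offset below `K` is the remainder modulo `K`.
scale-injective : ∀ K {a b x y} → x < K → y < K → a * K + x ≡ b * K + y → x ≡ y
scale-injective K {a} {b} {x} {y} x<K y<K eq with <-cmp a b
... | tri< a<b _ _  = contradiction eq (<⇒≢ (scale-< K a<b (m≤n⇒m≤n+o y x<K)))
... | tri≈ _ refl _ = +-cancelˡ-≡ (a * K) x y eq
... | tri> _ _ b<a  = contradiction (sym eq) (<⇒≢ (scale-< K b<a (m≤n⇒m≤n+o x y<K)))

-- The record serves both axes. Upper ends of horizontal segments will be the columns of the
-- vertical links, and lower ends of vertical segments, up to a shift, the rows of the horizontal
-- links; injectivity keeps these lines distinct.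
record GeneralPosition {n} (S : Fin n → Segment) : Set where
  field
    T            : Fin n → Segment
    nonempty     : ∀ v → Nonempty (T v)
    lo-injective : ∀ {v w} → lo (T v) ≡ lo (T w) → v ≡ w
    hi-injective : ∀ {v w} → hi (T v) ≡ hi (T w) → v ≡ w
    overlap⇔     : ∀ {v w} → v ≢ w → Overlap (T v) (T w) ⇔ Overlap (S v) (S w)

module _ {n} (S : Fin n → Segment) where

  private
    L : ℕ
    L = proj₁ (bounded (line ∘ S))

    line<L : ∀ v → line (S v) < L
    line<L = proj₂ (bounded (line ∘ S))

  -- Each staircase needs a main segment on both axes. An empty one becomes a unit segment on the
  -- private line `L + toℕ v`, beyond all lines of `S`, where it overlaps no other.
  filled : Fin n → Segment
  filled v with lo (S v) <? hi (S v)
  ... | yes _ = S v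
  ... | no _  = seg (L + toℕ v) 0 1

  filled-nonempty : ∀ v → Nonempty (filled v)
  filled-nonempty v with lo (S v) <? hi (S v)
  ... | yes lt = lt
  ... | no _   = s≤s z≤n

  filled-overlap : ∀ {v w} → v ≢ w → Overlap (filled v) (filled w) ⇔ Overlap (S v) (S w)
  filled-overlap {v} {w} v≢w with lo (S v) <? hi (S v) | lo (S w) <? hi (S w)
  ... | yes _ | yes _ = mk⇔ (λ o → o) (λ o → o)
  ... | yes _ | no ¬t = mk⇔ (λ o → contradiction (proj₁ o) (<⇒≢ (m≤n⇒m≤n+o _ (line<L v))))
                            (λ (_ , _ , _ , t) → contradiction t ¬t)
  ... | no ¬s | yes _ = mk⇔ (λ o → contradiction (sym (proj₁ o)) (<⇒≢ (m≤n⇒m≤n+o _ (line<L w))))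
                            (λ (_ , _ , s , _) → contradiction s ¬s)
  ... | no ¬s | no _  = mk⇔ (λ o → contradiction (toℕ-injective (+-cancelˡ-≡ L _ _ (proj₁ o))) v≢w)
                            (λ (_ , _ , s , _) → contradiction s ¬s)

  -- Within each block of length 2n, upper ends occupy the first half and lower
  -- ends the second half, so that segments which merely touch stay apart.
  scaled : Fin n → Segment → Segment
  scaled v (seg l a b) = seg l (a * (n + n) + (n + toℕ v)) (b * (n + n) + toℕ v)

  private
    -- The offset of a lower end is at least that of an upper end and exceeds it by less than
    -- `n + n`, so the comparison is decided by the blocks alone.
    ends⇔ : ∀ v w {a b} → a * (n + n) + (n + toℕ v) < b * (n + n) + toℕ w ⇔ a < b
    ends⇔ v w = mk⇔ (scale-<⁻¹ (n + n) (m≤n⇒m≤n+o (toℕ v) (<⇒≤ (toℕ<n w))))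
                    (λ lt → scale-< (n + n) lt (m≤n⇒m≤n+o _ (+-monoʳ-< n (toℕ<n v))))

  scaled-overlap : ∀ v w {T U} → Overlap (scaled v T) (scaled w U) ⇔ Overlap T U
  scaled-overlap v w = mk⇔
    (λ (l , (a , b) , c , d) →
      l , (to (ends⇔ v w) a , to (ends⇔ w v) b) , to (ends⇔ v v) c , to (ends⇔ w w) d)
    (λ (l , (a , b) , c , d) →
      l , (from (ends⇔ v w) a , from (ends⇔ w v) b) , from (ends⇔ v v) c , from (ends⇔ w w) d)

  generalPosition : GeneralPosition S
  generalPosition = record
    { T            = λ v → scaled v (filled v)
    ; nonempty     = λ v → from (ends⇔ v v) (filled-nonempty v)
    ; lo-injective = λ {v} {w} eq → toℕ-injective (+-cancelˡ-≡ n _ _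
        (scale-injective (n + n) {lo (filled v)} {lo (filled w)}
          (+-monoʳ-< n (toℕ<n v)) (+-monoʳ-< n (toℕ<n w)) eq))
    ; hi-injective = λ {v} {w} eq → toℕ-injective
        (scale-injective (n + n) {hi (filled v)} {hi (filled w)}
          (m≤n⇒m≤n+o n (toℕ<n v)) (m≤n⇒m≤n+o n (toℕ<n w)) eq)
    ; overlap⇔     = λ {v} {w} v≢w → mk⇔
        (to (filled-overlap v≢w) ∘ to (scaled-overlap v w))
        (from (scaled-overlap v w) ∘ from (filled-overlap v≢w))
    }

shift : ℕ → ℕ → Segment → Segment
shift M R (seg l a b) = seg (M + l) (R + a) (R + b)

shift-overlap : ∀ M R {S T} → Overlap (shift M R S) (shift M R T) ⇔ Overlap S T
shift-overlap M R = mk⇔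
  (λ (l , (a , b) , c , d) → +-cancelˡ-≡ M _ _ l
    , (+-cancelˡ-< R _ _ a , +-cancelˡ-< R _ _ b) , +-cancelˡ-< R _ _ c , +-cancelˡ-< R _ _ d)
  (λ (l , (a , b) , c , d) → cong (M +_) l
    , (+-monoʳ-< R a , +-monoʳ-< R b) , +-monoʳ-< R c , +-monoʳ-< R d)

-- The family of staircases and its shared edges

module Staircases {n} (S : Axis → Fin n → Segment) where

  private
    module H = GeneralPosition (generalPosition (S hor))
    module V = GeneralPosition (generalPosition (S ver))

    -- Translating by `M` columns and `R` rows puts the vertical main segments strictly to the right
    -- of and above all horizontal ones.
    M R : ℕ
    M = proj₁ (bounded (hi ∘ H.T))
    R = proj₁ (bounded (line ∘ H.T))

    hi<M : ∀ v → hi (H.T v) < M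
    hi<M = proj₂ (bounded (hi ∘ H.T))

    line<R : ∀ v → line (H.T v) < R
    line<R = proj₂ (bounded (line ∘ H.T))

    -- The inequality proofs fix the remaining coordinates: `x₀` and `x₁` are the ends of `H.T v`,
    -- and `y₂` is `R + hi (V.T v)`.
    module St (v : Fin n) = Staircase
      {x₂ = M + line (V.T v)} {y₀ = line (H.T v)} {y₁ = R + lo (V.T v)}
      (H.nonempty v) (m≤n⇒m≤n+o _ (<⇒≤ (hi<M v)))
      (m≤n⇒m≤n+o _ (<⇒≤ (line<R v))) (+-monoʳ-≤ R (<⇒≤ (V.nonempty v)))

    grid : Grid
    grid = square (proj₁ (fitAll St.staircase))

  staircasePath : Fin n → Path grid
  staircasePath v = record
    { points     = St.staircase v
    ; onGrid     = proj₂ (fitAll St.staircase) v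
    ; connected  = walk-connected _ (St.steps v)
    ; simple     = walk-unique _ (St.steps v)
    ; nontrivial = St.staircase-nontrivial v
    }

  staircasePath-monotonic : ∀ v → Monotonic (staircasePath v)
  staircasePath-monotonic v = inj₁ (walk-ascending _ (St.steps v))

  staircasePath-bends : ∀ v → bends (staircasePath v) ≤ 3
  staircasePath-bends = St.staircase-bends

  private
    -- Horizontal links lie in rows from `R` on, above the horizontal main segments; vertical links
    -- lie in columns below `M`, left of the vertical main segments.
    link≢main : ∀ A v w → line (St.link v A) ≢ line (St.main w A)
    link≢main hor v w eq = <⇒≢ (m≤n⇒m≤n+o _ (line<R w)) (sym eq)
    link≢main ver v w eq = <⇒≢ (m≤n⇒m≤n+o _ (hi<M v)) eq

    link-injective : ∀ A {v w} → line (St.link v A) ≡ line (St.link w A) → v ≡ w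
    link-injective hor = V.lo-injective ∘ +-cancelˡ-≡ R _ _
    link-injective ver = H.hi-injective

    main-overlap : ∀ A {v w} → v ≢ w → Overlap (St.main v A) (St.main w A) ⇔ Overlap (S A v) (S A w)
    main-overlap hor v≢w = H.overlap⇔ v≢w
    -- `St.main v ver` computes to `shift M R (V.T v)`.
    main-overlap ver v≢w = mk⇔ (to (V.overlap⇔ v≢w) ∘ to (shift-overlap M R))
                               (from (shift-overlap M R) ∘ from (V.overlap⇔ v≢w))

  shareEdge⇔overlap : ∀ {v w} → v ≢ w →
    ShareEdge (staircasePath v) (staircasePath w) ⇔ ∃ λ A → Overlap (S A v) (S A w)
  shareEdge⇔overlap {v} {w} v≢w = mk⇔ overlaps share
    where
    share : (∃ λ A → Overlap (S A v) (S A w)) → ShareEdge (staircasePath v) (staircasePath w)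
    share (A , o) with x , onv , onw ← to (overlap⇔common A) (from (main-overlap A v≢w) o) =
      from (shareEdge⇔ {P = staircasePath v} {staircasePath w})
        (A , x , St.main⇒usesEdge v A onv , St.main⇒usesEdge w A onw)

    overlaps : ShareEdge (staircasePath v) (staircasePath w) → ∃ λ A → Overlap (S A v) (S A w)
    overlaps s with A , x , uv , uw ← to (shareEdge⇔ {P = staircasePath v} {staircasePath w}) s
      with St.usesEdge⇒on v A uv | St.usesEdge⇒on w A uw
    -- Only two main segments can share an edge: a link and a main segment of the same axis have
    -- different lines, and two links on one line would force `v ≡ w`.
    ... | inj₁ onv     | inj₁ onw     = A , to (main-overlap A v≢w) (from (overlap⇔common A) (x , onv , onw))
    ... | inj₁ (l , _) | inj₂ (m , _) = contradiction (trans (sym m) l) (link≢main A w v)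
    ... | inj₂ (l , _) | inj₁ (m , _) = contradiction (trans (sym l) m) (link≢main A v w)
    ... | inj₂ (l , _) | inj₂ (m , _) = contradiction (link-injective A (trans (sym l) m)) v≢w

-- Passage from the given representation to the staircases

covered⇒shareEdge⇔ : ∀ {Γ} {P Q : Path Γ} (cP : ∀ A → Covered A (points P)) (cQ : ∀ A → Covered A (points Q)) →
                     ShareEdge P Q ⇔ ∃ λ A → Overlap (proj₁ (cP A)) (proj₁ (cQ A))
covered⇒shareEdge⇔ {P = P} {Q} cP cQ = mk⇔ overlaps share
  where
  overlaps : ShareEdge P Q → ∃ λ A → Overlap (proj₁ (cP A)) (proj₁ (cQ A))
  overlaps s with A , x , u , v ← to (shareEdge⇔ {P = P} {Q}) s =
    A , from (overlap⇔common A) (x , to (proj₂ (cP A) x) u , to (proj₂ (cQ A) x) v)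

  share : (∃ λ A → Overlap (proj₁ (cP A)) (proj₁ (cQ A))) → ShareEdge P Q
  share (A , o) with x , u , v ← to (overlap⇔common A) o =
    from (shareEdge⇔ {P = P} {Q}) (A , x , from (proj₂ (cP A) x) u , from (proj₂ (cQ A) x) v)

theorem4p2 : B 1 ⊆ Bᵐ 3
theorem4p2 {G} (R , bends≤1) =
  record { path = staircasePath ; adjacent = adjacent′ } , λ v → staircasePath-monotonic v , staircasePath-bends v
  where
  open Graph G

  covered : ∀ v A → Covered A (points (path R v))
  covered v = oneBend⇒covered (connected (path R v)) (nontrivial (path R v)) (bends≤1 v)

  S : Axis → Vertex → Segment
  S A v = proj₁ (covered v A)

  open Staircases S

  adjacent′ : ∀ v w → v ≢ w → (v ~ w) ⇔ ShareEdge (staircasePath v) (staircasePath w)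
  -- Old and new paths are compared through the overlaps of the same segments `S`.
  adjacent′ v w v≢w = mk⇔
    (from (shareEdge⇔overlap v≢w) ∘ to old ∘ to (EPG.adjacent R v w v≢w))
    (from (EPG.adjacent R v w v≢w) ∘ from old ∘ to (shareEdge⇔overlap v≢w))
    where
    old : ShareEdge (path R v) (path R w) ⇔ (∃ λ A → Overlap (S A v) (S A w))
    old = covered⇒shareEdge⇔ {P = path R v} {path R w} (covered v) (covered w)
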